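{- Let $K$ be any complex bi-quadratic field with ring of integers $\mathcal{O}_K$. Then every element of $4\mathcal{O}_K=\{4\beta:\beta\in\mathcal{O}_K\}$ can be written as a sum of five squares of elements of $\mathcal{O}_K$.
   Context: A complex bi-quadratic field is a number field of the form $\mathbb{Q}(\sqrt{a},\sqrt{b})$ of degree $4$ over $\mathbb{Q}$ (with $a,b$ square-free integers) which is not totally real, i.e. which contains an imaginary quadratic subfield. -}

module Defs where

open import Data.Nat using (ℕ)
open import Data.Integer as ℤ using (ℤ; ∣_∣)
open import Data.Rational as ℚ using (ℚ; 0ℚ; 1ℚ)
open import Data.Nat.Divisibility using (_∣_)
open import Data.List using (List; []; _∷_)
open import Data.Product using (∃; _×_)
open import Data.Sum using (_⊎_)
open import Relation.Binary.PropositionalEquality using (_≡_)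
open import Relation.Nullary using (¬_)

-- A square-free integer: no square d² > 1 divides it (this excludes 0).
SquareFree : ℤ → Set
SquareFree a = ∀ (d : ℕ) → (d ℕ.* d) ∣ ∣ a ∣ → d ≡ 1
  where import Data.Nat as ℕ

IsSquareℤ : ℤ → Set
IsSquareℤ a = ∃ λ (n : ℤ) → n ℤ.* n ≡ a

-- Parameters (a , b) define a complex bi-quadratic field Q(√a, √b):
-- a, b square-free; degree 4 (none of a, b, ab is a square);
-- not totally real (one of the quadratic subfields Q(√a), Q(√b), Q(√ab) is imaginary).
record BiquadParams (a b : ℤ) : Set where
  field
    sqfree-a : SquareFree a
    sqfree-b : SquareFree b
    nonsq-a  : ¬ IsSquareℤ a
    nonsq-b  : ¬ IsSquareℤ b
    nonsq-ab : ¬ IsSquareℤ (a ℤ.* b)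
    complex  : (a ℤ.< ℤ.0ℤ) ⊎ ((b ℤ.< ℤ.0ℤ) ⊎ (a ℤ.* b ℤ.< ℤ.0ℤ))

-- Elements of K = Q(√a, √b) = Q[X,Y]/(X² - a, Y² - b), written
-- x0 + x1 √a + x2 √b + x3 √a√b with rational coordinates.
record K : Set where
  constructor ⟨_,_,_,_⟩
  field
    c0 c1 c2 c3 : ℚ

module Arith (a b : ℤ) where
  private
    qa qb : ℚ
    qa = a ℚ./ 1
    qb = b ℚ./ 1
    _+_ = ℚ._+_
    _*_ = ℚ._*_
    infixl 6 _+_
    infixl 7 _*_

  embℤ : ℤ → K
  embℤ n = ⟨ n ℚ./ 1 , 0ℚ , 0ℚ , 0ℚ ⟩

  zeroK oneK : K
  zeroK = ⟨ 0ℚ , 0ℚ , 0ℚ , 0ℚ ⟩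
  oneK  = ⟨ 1ℚ , 0ℚ , 0ℚ , 0ℚ ⟩

  _+K_ : K → K → K
  ⟨ x0 , x1 , x2 , x3 ⟩ +K ⟨ y0 , y1 , y2 , y3 ⟩ =
    ⟨ x0 + y0 , x1 + y1 , x2 + y2 , x3 + y3 ⟩

  -- (√a)² = a, (√b)² = b, (√a√b)² = ab, √a·√a√b = a√b, √b·√a√b = b√a
  _*K_ : K → K → K
  ⟨ x0 , x1 , x2 , x3 ⟩ *K ⟨ y0 , y1 , y2 , y3 ⟩ =
    ⟨ x0 * y0 + qa * x1 * y1 + qb * x2 * y2 + qa * qb * x3 * y3
    , x0 * y1 + x1 * y0 + qb * (x2 * y3 + x3 * y2)
    , x0 * y2 + x2 * y0 + qa * (x1 * y3 + x3 * y1)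
    , x0 * y3 + x3 * y0 + x1 * y2 + x2 * y1 ⟩

  infixl 6 _+K_
  infixl 7 _*K_

  -- Value at x of the monic integer polynomial
  -- X^n + c_{n-1} X^{n-1} + ... + c_0, for cs = c_0 ∷ ... ∷ c_{n-1} ∷ [].
  evalMonic : List ℤ → K → K
  evalMonic []       x = oneK
  evalMonic (c ∷ cs) x = embℤ c +K x *K evalMonic cs x

  IsAlgInt : K → Set
  IsAlgInt x = ∃ λ (cs : List ℤ) → evalMonic cs x ≡ zeroK

  SumOfFiveIntSquares : K → Set
  SumOfFiveIntSquares y =
    ∃ λ x1 → ∃ λ x2 → ∃ λ x3 → ∃ λ x4 → ∃ λ x5 →
      IsAlgInt x1 × IsAlgInt x2 × IsAlgInt x3 × IsAlgInt x4 × IsAlgInt x5 ×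
      (y ≡ x1 *K x1 +K x2 *K x2 +K x3 *K x3 +K x4 *K x4 +K x5 *K x5)

{-# OPTIONS --safe #-}

-- For an imaginary s = √-d in K, Lagrange gives d = p₁² + p₂² + p₃² + p₄², so that the vector
-- p = (p₁ , … , p₄ , s) is isotropic. As d is square-free the pᵢ have no common factor, and Bézout
-- provides an integer vector w with w · p = 1. Then q = 2 w - |w|² p is isotropic too and p · q = 2,
-- whence |p + β q|² = 4 β. The coordinates of p + β q are integral because they are of the form
-- u β + v with u, v ∈ ℤ[s].

module Submission where

open import Defs
open import Data.Integer using (ℤ; +_)

open import Algebra.Bundles using (CommutativeRing)
open import Algebra.Morphism.Structures using (IsRingHomomorphism)
import Algebra.Solver.Ring
import Algebra.Solver.Ring.AlmostCommutativeRing as ACR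
open import Algebra.Structures using (IsCommutativeRing)
open import Data.Fin.Base using (Fin; toℕ; fromℕ<; splitAt; join)
import Data.Fin.Properties as Fin
open import Data.Integer as ℤ using (0ℤ; 1ℤ; -1ℤ; -[1+_]; ∣_∣; +≤+; +<+)
import Data.Integer.DivMod as ℤ
import Data.Integer.Properties as ℤ
import Data.Integer.Tactic.RingSolver as ℤ-Solver
open import Data.List.Base using ([]; _∷_; length)
open import Data.List.Relation.Unary.All using (All; []; _∷_)
open import Data.Maybe.Base as Maybe using (Maybe)
open import Data.Nat.Base as ℕ using (ℕ; zero; suc)
import Data.Nat.Divisibility as ℕ
import Data.Nat.DivMod as ℕ
open import Data.Nat.GCD using (GCD; module Bézout)
open import Data.Nat.Induction using (<-wellFounded)
open import Data.Nat.ListAction using (product)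
open import Data.Nat.Primality using (Prime; euclidsLemma; prime⇒irreducible; prime⇒nonZero; prime⇒nonTrivial)
open import Data.Nat.Primality.Factorisation using (factorise)
import Data.Nat.Properties as ℕ
open import Data.Product using (_,_; ∃; _×_)
open import Data.Rational as ℚ using (ℚ; 0ℚ; 1ℚ)
import Data.Rational.Properties as ℚ
open import Data.Rational.Unnormalised using (mkℚᵘ; *≡*)
import Data.Rational.Unnormalised.Properties as ℚᵘ
open import Data.Sum.Base using (_⊎_; inj₁; inj₂; [_,_]′)
open import Function.Base using (_∘_; id)
open import Induction.WellFounded using (Acc; acc)
open import Level using (0ℓ)
open import Relation.Binary.Definitions using (tri<; tri≈; tri>)
open import Relation.Binary.PropositionalEquality using (_≡_; subst)
open import Relation.Nullary using (yes; no; contradiction; ¬_)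
open import Relation.Nullary.Decidable.Core using (dec⇒maybe)
open import Tactic.RingSolver.Core.AlmostCommutativeRing using (AlmostCommutativeRing; fromCommutativeRing)

-- Two isotropic vectors with p · q = 2 satisfy |x p + y q|² = 4 x y, and x = 1, y = β is the
-- instance used. The standard isotropic partner of p in a hyperbolic plane is w - (|w|² / 2) p,
-- whose product with p is 1; doubling it clears the denominator, and this doubling is the origin of
-- the factor 4. The last coordinate of w is 0, so w · p = 1 is a statement about integers alone.
-- The obstacle is integrality, which has to be certified by explicit monic integer polynomials.
-- Closure of the integral elements under arbitrary sums and products is avoided: every coordinate
-- has the shape u β + v over ℤ[s], so it suffices to carry a polynomial of β over to one of u β + v
-- with coefficients in ℤ[s], and then to remove the quadratic s by taking a norm.

-- Polynomial values and integral elements.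

module Integrality (R : CommutativeRing 0ℓ 0ℓ) (ι : ℤ → CommutativeRing.Carrier R)
  (ι-hom : IsRingHomomorphism ℤ.+-*-rawRing (CommutativeRing.rawRing R) ι) where

  open CommutativeRing R
  open IsRingHomomorphism ι-hom using (+-homo; *-homo; 0#-homo; 1#-homo; -‿homo; ⟦⟧-cong)
  open import Relation.Binary.Reasoning.Setoid setoid

  private
    ι-morphism : ℤ.+-*-rawRing ACR.-Raw-AlmostCommutative⟶ ACR.fromCommutativeRing R
    ι-morphism = record
      { ⟦_⟧ = ι ; +-homo = +-homo ; *-homo = *-homo ; -‿homo = -‿homo ; 0-homo = 0#-homo ; 1-homo = 1#-homo }

    ι-≟ : ∀ i j → Maybe (ι i ≈ ι j)
    ι-≟ i j = Maybe.map ⟦⟧-cong (dec⇒maybe (i ℤ.≟ j))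

  open Algebra.Solver.Ring ℤ.+-*-rawRing (ACR.fromCommutativeRing R) ι-morphism ι-≟
    using (solve; _:=_; _:+_; _:*_; _:-_; :-_; con)

  -- Value x l n v: v is the value at x of an integer polynomial l Xⁿ + (lower terms).
  -- The case l = 0 is that of a polynomial of degree less than n.
  data Value (x : Carrier) : ℤ → ℕ → Carrier → Set where
    const : ∀ {l v} → v ≈ ι l → Value x l 0 v
    _+x*_by_ : ∀ {l n v w} c → Value x l n w → v ≈ ι c + x * w → Value x l (suc n) v

  Integral : Carrier → Set
  Integral x = ∃ λ n → Value x 1ℤ n 0#

  module _ {x : Carrier} where

    Value-resp : ∀ {l n v w} → v ≈ w → Value x l n v → Value x l n w
    Value-resp v≈w (const eq) = const (trans (sym v≈w) eq)
    Value-resp v≈w (c +x* p by eq) = c +x* p by trans (sym v≈w) eq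

    Value-+ : ∀ {k l n v w} → Value x k n v → Value x l n w → Value x (k ℤ.+ l) n (v + w)
    Value-+ (const eq) (const eq′) = const (trans (+-cong eq eq′) (sym (+-homo _ _)))
    Value-+ (_+x*_by_ {w = v} c p eq) (_+x*_by_ {w = w} d q eq′) = (c ℤ.+ d) +x* Value-+ p q by (begin
      _                               ≈⟨ +-cong eq eq′ ⟩
      (ι c + x * v) + (ι d + x * w)   ≈⟨ solve 5 (λ x c d v w → (c :+ x :* v) :+ (d :+ x :* w)
                                            := (c :+ d) :+ x :* (v :+ w)) refl x (ι c) (ι d) v w ⟩
      (ι c + ι d) + x * (v + w)       ≈⟨ +-congʳ (+-homo c d) ⟨
      ι (c ℤ.+ d) + x * (v + w)       ∎)

    Value-scale : ∀ k {l n v} → Value x l n v → Value x (k ℤ.* l) n (ι k * v)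
    Value-scale k (const eq) = const (trans (*-congˡ eq) (sym (*-homo _ _)))
    Value-scale k (_+x*_by_ {w = v} c p eq) = (k ℤ.* c) +x* Value-scale k p by (begin
      _                            ≈⟨ *-congˡ eq ⟩
      ι k * (ι c + x * v)          ≈⟨ solve 4 (λ x k c v → k :* (c :+ x :* v)
                                        := k :* c :+ x :* (k :* v)) refl x (ι k) (ι c) v ⟩
      ι k * ι c + x * (ι k * v)    ≈⟨ +-congʳ (*-homo k c) ⟨
      ι (k ℤ.* c) + x * (ι k * v)  ∎)

    Value-x* : ∀ {l n v} → Value x l n v → Value x l (suc n) (x * v)
    Value-x* p = 0ℤ +x* p by sym (trans (+-congʳ 0#-homo) (+-identityˡ _))

    Value-0 : ∀ n → Value x 0ℤ n 0#
    Value-0 zero = const (sym 0#-homo)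
    Value-0 (suc n) = Value-resp (zeroʳ x) (Value-x* (Value-0 n))

    Value-const : ∀ k n → Value x 0ℤ (suc n) (ι k)
    Value-const k n = k +x* Value-0 n by sym (trans (+-congˡ (zeroʳ x)) (+-identityʳ _))

    -- The same polynomial is given a formal degree one higher, with leading coefficient 0. This
    -- padding lets summands of different degrees be added.
    Value-suc : ∀ {l n v} → Value x l n v → Value x 0ℤ (suc n) v
    Value-suc {l} (const eq) = Value-resp (sym eq) (Value-const l 0)
    Value-suc (c +x* p by eq) = c +x* Value-suc p by eq

    Value-suc-+ : ∀ m {l n v} → Value x l n v → Value x 0ℤ (suc m ℕ.+ n) v
    Value-suc-+ zero p = Value-suc p
    Value-suc-+ (suc m) p = Value-suc (Value-suc-+ m p)

    Value-* : ∀ {k l m n v w} → Value x k m v → Value x l n w → Value x (k ℤ.* l) (m ℕ.+ n) (v * w)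
    Value-* {k} (const eq) q = Value-resp (*-congʳ (sym eq)) (Value-scale k q)
    Value-* {k} {l} {suc m} {w = w} (_+x*_by_ {w = v} c p eq) q =
      Value-resp (sym (begin
        _                       ≈⟨ *-congʳ eq ⟩
        (ι c + x * v) * w       ≈⟨ distribʳ w (ι c) (x * v) ⟩
        ι c * w + x * v * w     ≈⟨ +-congˡ (*-assoc x v w) ⟩
        ι c * w + x * (v * w)   ∎))
      -- The summand `ι c * w` has too low a degree; padded with zero coefficients it leaves the
      -- leading coefficient `k ℤ.* l` of the other summand unchanged.
      (subst (λ i → Value x i _ _) (ℤ.+-identityˡ (k ℤ.* l))
        (Value-+ (Value-suc-+ m (Value-scale c q)) (Value-x* (Value-* p q))))

  -- If p(δ) = 0 with p monic of degree n and γ = u δ + v with u, v ∈ ℤ[s], then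
  -- uⁿ p(δ) = P + s Q where P is monic of degree n in γ and Q has lower degree;
  -- P² - s² Q² then vanishes.
  module _ {s γ δ : Carrier} {a u₀ u₁ v₀ v₁ : ℤ} (s²≈a : s * s ≈ ι a)
    (γ≈uδ+v : γ ≈ (ι u₀ + ι u₁ * s) * δ + (ι v₀ + ι v₁ * s)) where

    private
      -- `y` and `z` are the coordinates of uⁿ in ℤ[s]. Keeping `P` and `Q` apart ensures that both
      -- are polynomials in γ over ℤ, with s only as an outer factor.
      record Split (l : ℤ) (n : ℕ) (w : Carrier) : Set where
        field
          y z : ℤ
          P Q : Carrier
          valueP : Value γ l n P
          valueQ : Value γ 0ℤ n Q
          split : (ι y + ι z * s) * w ≈ P + s * Q

      lin : ∀ {l n P Q} i j k → Value γ l n P → Value γ 0ℤ n Q →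
        Value γ l (suc n) (ι i + (γ * P + (ι j * P + ι k * Q)))
      lin {l} {n} i j k p q = subst (λ m → Value γ m _ _) (leading l)
        (Value-+ (Value-const i n) (Value-+ (Value-x* p)
          (Value-+ (Value-suc (Value-scale j p)) (Value-suc (Value-scale k q)))))
        where
        leading : ∀ l → 0ℤ ℤ.+ (l ℤ.+ (0ℤ ℤ.+ 0ℤ)) ≡ l
        leading = ℤ-Solver.solve-∀

      -- The new `Q` receives a multiple of `P`, but without the factor γ, so its degree stays below
      -- that of the new `P`.
      lin₀ : ∀ {l n P Q} i j k → Value γ l n P → Value γ 0ℤ n Q →
        Value γ 0ℤ (suc n) (ι i + (γ * Q + (ι j * P + ι k * Q)))
      lin₀ {l} {n} i j k p q =
        Value-+ (Value-const i n) (Value-+ (Value-x* q)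
          (Value-+ (Value-suc (Value-scale j p)) (Value-suc (Value-scale k q))))

      split-Value : ∀ {l n w} → Value δ l n w → Split l n w
      split-Value {l} {w = w} (const eq) = record
        { y = 1ℤ ; z = 0ℤ ; P = w ; Q = 0# ; valueP = const eq ; valueQ = Value-0 0
        ; split = begin
            (ι 1ℤ + ι 0ℤ * s) * w  ≈⟨ *-congʳ (+-cong 1#-homo (*-congʳ 0#-homo)) ⟩
            (1# + 0# * s) * w      ≈⟨ *-congʳ (+-congˡ (zeroˡ s)) ⟩
            (1# + 0#) * w          ≈⟨ *-congʳ (+-identityʳ 1#) ⟩
            1# * w                 ≈⟨ *-identityˡ w ⟩
            w                      ≈⟨ +-identityʳ w ⟨
            w + 0#                 ≈⟨ +-congˡ (zeroʳ s) ⟨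
            w + s * 0#             ∎
        }
      split-Value (_+x*_by_ {l} {n} {v} {w} c p eq) with split-Value p
      ... | record { y = y ; z = z ; P = P ; Q = Q ; valueP = valueP ; valueQ = valueQ ; split = split } = record
        { y = y′ ; z = z′
        ; valueP = lin (c ℤ.* y′) (ℤ.- v₀) (ℤ.- (a ℤ.* v₁)) valueP valueQ
        ; valueQ = lin₀ (c ℤ.* z′) (ℤ.- v₁) (ℤ.- v₀) valueP valueQ
        ; split = begin
            (ι y′ + ι z′ * s) * v
              ≈⟨ *-cong (+-cong y′≈ (*-congʳ z′≈)) eq ⟩
            (Y′ + Z′ * s) * (ι c + δ * w)
              -- With u and v for the two elements of ℤ[s], uⁿ⁺¹ (c + δ w) = c uⁿ⁺¹ + (u δ) (uⁿ w).
              -- Adding and subtracting v exposes u δ + v, which becomes γ, while uⁿ w is known by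
              -- induction.
              ≈⟨ solve 10 (λ s δ u₀ u₁ v₀ v₁ y z c w →
                   ((u₀ :* y :+ s :* s :* (u₁ :* z)) :+ (u₀ :* z :+ u₁ :* y) :* s) :* (c :+ δ :* w)
                   := c :* ((u₀ :* y :+ s :* s :* (u₁ :* z)) :+ (u₀ :* z :+ u₁ :* y) :* s)
                     :+ ((u₀ :+ u₁ :* s) :* δ :+ (v₀ :+ v₁ :* s) :- (v₀ :+ v₁ :* s)) :* ((y :+ z :* s) :* w))
                   refl s δ (ι u₀) (ι u₁) (ι v₀) (ι v₁) (ι y) (ι z) (ι c) w ⟩
            ι c * (Y′ + Z′ * s)
              + ((ι u₀ + ι u₁ * s) * δ + (ι v₀ + ι v₁ * s) - (ι v₀ + ι v₁ * s)) * ((ι y + ι z * s) * w)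
              ≈⟨ +-congˡ (*-cong (+-congʳ (sym γ≈uδ+v)) split) ⟩
            ι c * (Y′ + Z′ * s) + (γ - (ι v₀ + ι v₁ * s)) * (P + s * Q)
              -- Separation of the terms with and without an outer factor s; the square s² arising
              -- from v₁ s · s Q is the integer a.
              ≈⟨ solve 9 (λ s γ v₀ v₁ c y z P Q →
                   c :* (y :+ z :* s) :+ (γ :- (v₀ :+ v₁ :* s)) :* (P :+ s :* Q)
                   := (c :* y :+ (γ :* P :+ (:- v₀ :* P :+ :- (s :* s :* v₁) :* Q)))
                     :+ s :* (c :* z :+ (γ :* Q :+ (:- v₁ :* P :+ :- v₀ :* Q))))
                   refl s γ (ι v₀) (ι v₁) (ι c) Y′ Z′ P Q ⟩
            (ι c * Y′ + (γ * P + (- ι v₀ * P + - (s * s * ι v₁) * Q)))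
              + s * (ι c * Z′ + (γ * Q + (- ι v₁ * P + - ι v₀ * Q)))
              ≈⟨ +-cong
                   (+-cong (trans (*-homo c y′) (*-congˡ y′≈)) (+-congˡ (+-cong (*-congʳ (-‿homo v₀))
                     (*-congʳ (trans (-‿homo _) (-‿cong (trans (*-homo a v₁) (*-congʳ (sym s²≈a)))))))))
                   (*-congˡ (+-cong (trans (*-homo c z′) (*-congˡ z′≈))
                     (+-congˡ (+-cong (*-congʳ (-‿homo v₁)) (*-congʳ (-‿homo v₀)))))) ⟨
            (ι (c ℤ.* y′) + (γ * P + (ι (ℤ.- v₀) * P + ι (ℤ.- (a ℤ.* v₁)) * Q)))
              + s * (ι (c ℤ.* z′) + (γ * Q + (ι (ℤ.- v₁) * P + ι (ℤ.- v₀) * Q)))  ∎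
        }
        where
        y′ z′ : ℤ
        y′ = u₀ ℤ.* y ℤ.+ a ℤ.* (u₁ ℤ.* z)
        z′ = u₀ ℤ.* z ℤ.+ u₁ ℤ.* y
        Y′ Z′ : Carrier
        Y′ = ι u₀ * ι y + s * s * (ι u₁ * ι z)
        Z′ = ι u₀ * ι z + ι u₁ * ι y
        y′≈ : ι y′ ≈ Y′
        y′≈ = trans (+-homo _ _) (+-cong (*-homo _ _) (trans (*-homo _ _) (*-cong (sym s²≈a) (*-homo _ _))))
        z′≈ : ι z′ ≈ Z′
        z′≈ = trans (+-homo _ _) (+-cong (*-homo _ _) (*-homo _ _))

    Integral-affine : Integral δ → Integral γ
    Integral-affine (n , p) with split-Value p
    ... | record { y = y ; z = z ; P = P ; Q = Q ; valueP = valueP ; valueQ = valueQ ; split = split } = n ℕ.+ n ,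
      Value-resp norm≈0 (subst (λ l → Value γ l (n ℕ.+ n) (P * P + ι (ℤ.- a) * (Q * Q))) (leading a)
        (Value-+ (Value-* valueP valueP) (Value-scale (ℤ.- a) (Value-* valueQ valueQ))))
      where
      leading : ∀ a → 1ℤ ℤ.* 1ℤ ℤ.+ ℤ.- a ℤ.* (0ℤ ℤ.* 0ℤ) ≡ 1ℤ
      leading = ℤ-Solver.solve-∀
      norm≈0 : P * P + ι (ℤ.- a) * (Q * Q) ≈ 0#
      norm≈0 = begin
        P * P + ι (ℤ.- a) * (Q * Q)    ≈⟨ +-congˡ (*-congʳ (trans (-‿homo a) (-‿cong (sym s²≈a)))) ⟩
        P * P + - (s * s) * (Q * Q)    ≈⟨ solve 3 (λ s P Q → P :* P :+ :- (s :* s) :* (Q :* Q)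
                                            := (P :+ s :* Q) :* (P :- s :* Q)) refl s P Q ⟩
        -- The first factor is uⁿ p(δ), and p(δ) = 0.
        (P + s * Q) * (P - s * Q)      ≈⟨ *-congʳ (trans (sym split) (zeroʳ _)) ⟩
        0# * (P - s * Q)               ≈⟨ zeroˡ _ ⟩
        0#                             ∎

  -- The five squares representing 4β.

  private
    dot-homo : ∀ w₁ w₂ w₃ w₄ p₁ p₂ p₃ p₄ →
      ι (w₁ ℤ.* p₁ ℤ.+ w₂ ℤ.* p₂ ℤ.+ w₃ ℤ.* p₃ ℤ.+ w₄ ℤ.* p₄)
      ≈ ι w₁ * ι p₁ + ι w₂ * ι p₂ + ι w₃ * ι p₃ + ι w₄ * ι p₄
    dot-homo _ _ _ _ _ _ _ _ =
      trans (+-homo _ _) (+-cong (trans (+-homo _ _) (+-cong (trans (+-homo _ _) (+-cong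
        (*-homo _ _) (*-homo _ _))) (*-homo _ _))) (*-homo _ _))

    -- Here p + β q = (1 - N β) p + 2 β w, and the right-hand side is the expansion of its square by
    -- bilinearity. It holds for every `N`; the value |w|² is inserted later. The summands
    -- `ι 0ℤ * s` keep each coordinate in the form u β + v expected by `Integral-affine`.
    4β-identity : ∀ s β w₁ w₂ w₃ w₄ p₁ p₂ p₃ p₄ N →
      let T = ι (+ 2)
          x = λ w p → (T * w - N * p + ι 0ℤ * s) * β + (p + ι 0ℤ * s)
          y = (ι 0ℤ + - N * s) * β + (ι 0ℤ + ι 1ℤ * s)
      in x w₁ p₁ * x w₁ p₁ + x w₂ p₂ * x w₂ p₂ + x w₃ p₃ * x w₃ p₃ + x w₄ p₄ * x w₄ p₄ + y * y
        ≈ (ι 1ℤ - N * β) * (ι 1ℤ - N * β) * (p₁ * p₁ + p₂ * p₂ + p₃ * p₃ + p₄ * p₄ + s * s)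
          + ι (+ 4) * β * (ι 1ℤ - N * β) * (w₁ * p₁ + w₂ * p₂ + w₃ * p₃ + w₄ * p₄)
          + ι (+ 4) * (β * β) * (w₁ * w₁ + w₂ * w₂ + w₃ * w₃ + w₄ * w₄)
    4β-identity = solve 11 (λ s β w₁ w₂ w₃ w₄ p₁ p₂ p₃ p₄ N →
      let x = λ w p → (con (+ 2) :* w :- N :* p :+ con 0ℤ :* s) :* β :+ (p :+ con 0ℤ :* s)
          y = (con 0ℤ :+ :- N :* s) :* β :+ (con 0ℤ :+ con 1ℤ :* s)
      in x w₁ p₁ :* x w₁ p₁ :+ x w₂ p₂ :* x w₂ p₂ :+ x w₃ p₃ :* x w₃ p₃ :+ x w₄ p₄ :* x w₄ p₄ :+ y :* y
        := (con 1ℤ :- N :* β) :* (con 1ℤ :- N :* β) :* (p₁ :* p₁ :+ p₂ :* p₂ :+ p₃ :* p₃ :+ p₄ :* p₄ :+ s :* s)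
          :+ con (+ 4) :* β :* (con 1ℤ :- N :* β) :* (w₁ :* p₁ :+ w₂ :* p₂ :+ w₃ :* p₃ :+ w₄ :* p₄)
          :+ con (+ 4) :* (β :* β) :* (w₁ :* w₁ :+ w₂ :* w₂ :+ w₃ :* w₃ :+ w₄ :* w₄)) refl

  4β-sum-of-five-squares : ∀ {s β a} p₁ p₂ p₃ p₄ w₁ w₂ w₃ w₄ → s * s ≈ ι a →
    p₁ ℤ.* p₁ ℤ.+ p₂ ℤ.* p₂ ℤ.+ p₃ ℤ.* p₃ ℤ.+ p₄ ℤ.* p₄ ≡ ℤ.- a →
    w₁ ℤ.* p₁ ℤ.+ w₂ ℤ.* p₂ ℤ.+ w₃ ℤ.* p₃ ℤ.+ w₄ ℤ.* p₄ ≡ 1ℤ →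
    Integral β → ∃ λ x₁ → ∃ λ x₂ → ∃ λ x₃ → ∃ λ x₄ → ∃ λ x₅ →
      Integral x₁ × Integral x₂ × Integral x₃ × Integral x₄ × Integral x₅ ×
      ι (+ 4) * β ≈ x₁ * x₁ + x₂ * x₂ + x₃ * x₃ + x₄ * x₄ + x₅ * x₅
  4β-sum-of-five-squares {s} {β} {a} p₁ p₂ p₃ p₄ w₁ w₂ w₃ w₄ s²≈a ∣p∣²≡-a w·p≡1 β-int =
    _ , _ , _ , _ , _ , x-int w₁ p₁ , x-int w₂ p₂ , x-int w₃ p₃ , x-int w₄ p₄ ,
    Integral-affine {s} {a = a} s²≈a refl β-int , sym (begin
      _ ≈⟨ +-cong (+-cong (+-cong (+-cong (x≈ w₁ p₁) (x≈ w₂ p₂)) (x≈ w₃ p₃)) (x≈ w₄ p₄)) y≈ ⟩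
      _ ≈⟨ 4β-identity s β (ι w₁) (ι w₂) (ι w₃) (ι w₄) (ι p₁) (ι p₂) (ι p₃) (ι p₄) (ι N) ⟩
      _ ≈⟨ +-cong (+-cong (*-congˡ isotropic) (*-congˡ (trans (sym (dot-homo w₁ w₂ w₃ w₄ p₁ p₂ p₃ p₄)) (⟦⟧-cong w·p≡1))))
             (*-congˡ (sym (dot-homo w₁ w₂ w₃ w₄ w₁ w₂ w₃ w₄))) ⟩
      -- Isotropy of p removes the first term, w · p = 1 simplifies the second, and because `N` is
      -- |w|² the two contributions in β² cancel.
      (ι 1ℤ - ι N * β) * (ι 1ℤ - ι N * β) * ι 0ℤ
        + ι (+ 4) * β * (ι 1ℤ - ι N * β) * ι 1ℤ
        + ι (+ 4) * (β * β) * ι N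
        ≈⟨ solve 2 (λ β N → (con 1ℤ :- N :* β) :* (con 1ℤ :- N :* β) :* con 0ℤ
             :+ con (+ 4) :* β :* (con 1ℤ :- N :* β) :* con 1ℤ
             :+ con (+ 4) :* (β :* β) :* N := con (+ 4) :* β) refl β (ι N) ⟩
      ι (+ 4) * β ∎)
    where
    N : ℤ
    N = w₁ ℤ.* w₁ ℤ.+ w₂ ℤ.* w₂ ℤ.+ w₃ ℤ.* w₃ ℤ.+ w₄ ℤ.* w₄

    x-int : ∀ w p → Integral ((ι (+ 2 ℤ.* w ℤ.- N ℤ.* p) + ι 0ℤ * s) * β + (ι p + ι 0ℤ * s))
    x-int w p = Integral-affine {s} {a = a} s²≈a refl β-int

    x≈ : ∀ w p → let x = (ι (+ 2 ℤ.* w ℤ.- N ℤ.* p) + ι 0ℤ * s) * β + (ι p + ι 0ℤ * s)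
                     x′ = (ι (+ 2) * ι w - ι N * ι p + ι 0ℤ * s) * β + (ι p + ι 0ℤ * s)
                 in x * x ≈ x′ * x′
    x≈ w p = *-cong eq eq
      where eq = +-congʳ (*-congʳ (+-congʳ (trans (+-homo _ _)
                   (+-cong (*-homo _ _) (trans (-‿homo _) (-‿cong (*-homo _ _)))))))

    y≈ : let y = (ι 0ℤ + ι (ℤ.- N) * s) * β + (ι 0ℤ + ι 1ℤ * s)
             y′ = (ι 0ℤ + - ι N * s) * β + (ι 0ℤ + ι 1ℤ * s)
         in y * y ≈ y′ * y′
    y≈ = *-cong eq eq
      where eq = +-congʳ (*-congʳ (+-congˡ (*-congʳ (-‿homo N))))

    isotropic : ι p₁ * ι p₁ + ι p₂ * ι p₂ + ι p₃ * ι p₃ + ι p₄ * ι p₄ + s * s ≈ ι 0ℤ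
    isotropic = begin
      _                    ≈⟨ +-cong (sym (dot-homo p₁ p₂ p₃ p₄ p₁ p₂ p₃ p₄)) s²≈a ⟩
      _                    ≈⟨ +-congʳ (⟦⟧-cong ∣p∣²≡-a) ⟩
      ι (ℤ.- a) + ι a      ≈⟨ +-homo (ℤ.- a) a ⟨
      ι (ℤ.- a ℤ.+ a)      ≈⟨ ⟦⟧-cong (ℤ.+-inverseˡ a) ⟩
      ι 0ℤ                 ∎

open import Relation.Binary.PropositionalEquality
  using (refl; sym; trans; cong; cong₂; subst₂; setoid; isEquivalence; module ≡-Reasoning)

-- Lagrange's four-square theorem.

module FourSquares where
  open import Data.Integer.Base using (_+_; _*_; _-_; -_; _≤_; _<_)
  open import Data.Integer.Divisibility.Signed using (_∣_; divides; ∣ᵤ⇒∣; ∣⇒∣ᵤ; ∣-trans)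
  open ℤ-Solver using (solve-∀)

  SumOfFourSquares : ℤ → Set
  SumOfFourSquares n = ∃ λ a → ∃ λ b → ∃ λ c → ∃ λ d → a * a + b * b + c * c + d * d ≡ n

  -- Multiplicativity of the quaternion norm: the four squared terms are the components of E times
  -- the conjugate of A, for A = a + b i + c j + d k and E = e + f i + g j + h k.
  euler-identity : ∀ a b c d e f g h →
    (a * e + b * f + c * g + d * h) * (a * e + b * f + c * g + d * h)
    + (a * f - b * e + c * h - d * g) * (a * f - b * e + c * h - d * g)
    + (a * g - b * h - c * e + d * f) * (a * g - b * h - c * e + d * f)
    + (a * h + b * g - c * f - d * e) * (a * h + b * g - c * f - d * e)
    ≡ (a * a + b * b + c * c + d * d) * (e * e + f * f + g * g + h * h)
  euler-identity = solve-∀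

  SumOfFourSquares-* : ∀ {m n} → SumOfFourSquares m → SumOfFourSquares n → SumOfFourSquares (m * n)
  SumOfFourSquares-* (a , b , c , d , refl) (e , f , g , h , refl) =
    a * e + b * f + c * g + d * h , a * f - b * e + c * h - d * g ,
    a * g - b * h - c * e + d * f , a * h + b * g - c * f - d * e , euler-identity a b c d e f g h

  square≡∣∣*∣∣ : ∀ i → i * i ≡ + (∣ i ∣ ℕ.* ∣ i ∣)
  square≡∣∣*∣∣ (+ n) = sym (ℤ.pos-* n n)
  square≡∣∣*∣∣ -[1+ n ] = refl

  0<i*i⊎i≡0 : ∀ i → 0ℤ ≤ i * i × (0ℤ < i * i ⊎ i ≡ 0ℤ)
  0<i*i⊎i≡0 (+ zero) = +≤+ ℕ.z≤n , inj₂ refl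
  0<i*i⊎i≡0 ℤ.+[1+ n ] = +≤+ ℕ.z≤n , inj₁ (+<+ (ℕ.s≤s ℕ.z≤n))
  0<i*i⊎i≡0 -[1+ n ] = +≤+ ℕ.z≤n , inj₁ (+<+ (ℕ.s≤s ℕ.z≤n))

  square-bound : ∀ i m → ∣ i ∣ ℕ.≤ m → i * i ≤ + m * + m × (i * i < + m * + m ⊎ + m ∣ i)
  square-bound i m i≤m rewrite square≡∣∣*∣∣ i | sym (ℤ.pos-* m m) with ℕ.m≤n⇒m<n∨m≡n i≤m
  ... | inj₁ i<m = +≤+ (ℕ.*-mono-≤ i≤m i≤m) , inj₁ (+<+ (ℕ.*-mono-< i<m i<m))
  ... | inj₂ i≡m = +≤+ (ℕ.*-mono-≤ i≤m i≤m) , inj₂ (∣ᵤ⇒∣ (ℕ.∣-reflexive (sym i≡m)))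

  private
    -- The second component records what equality would mean. A sum of such bounds is strict as soon
    -- as one summand is, so otherwise all the equality cases hold together, which is what the
    -- descent must know.
    StrictOr : ℤ → ℤ → Set → Set
    StrictOr i j A = i ≤ j × (i < j ⊎ A)

    strictOr-+ : ∀ {i j k l} {A B : Set} → StrictOr i j A → StrictOr k l B → StrictOr (i + k) (j + l) (A × B)
    strictOr-+ (i≤j , inj₁ i<j) (k≤l , _) = ℤ.+-mono-≤ i≤j k≤l , inj₁ (ℤ.+-mono-<-≤ i<j k≤l)
    strictOr-+ (i≤j , _) (k≤l , inj₁ k<l) = ℤ.+-mono-≤ i≤j k≤l , inj₁ (ℤ.+-mono-≤-< i≤j k<l)
    strictOr-+ (i≤j , inj₂ a) (k≤l , inj₂ b) = ℤ.+-mono-≤ i≤j k≤l , inj₂ (a , b)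

  -- The bound is on 2 α, so that no halving of m occurs and even and odd m are treated alike.
  nearest : ∀ i m .{{_ : ℕ.NonZero m}} → ∃ λ α → ∃ λ l → i ≡ α + l * + m × ∣ + 2 * α ∣ ℕ.≤ m
  nearest i m with r ℕ.+ r ℕ.≤? m
    where r = i ℤ.%ℕ m
  ... | yes 2r≤m = + r , i ℤ./ℕ m , ℤ.a≡a%ℕn+[a/ℕn]*n i m ,
        subst (ℕ._≤ m) (sym (trans (ℤ.abs-* (+ 2) (+ r)) (cong (r ℕ.+_) (ℕ.+-identityʳ r)))) 2r≤m
    where r = i ℤ.%ℕ m
  -- The remainder exceeds m / 2, so it is replaced by r - m = - k and the quotient is raised by
  -- one.
  ... | no 2r≰m = - + k , i ℤ./ℕ m + 1ℤ , eq ,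
        subst (ℕ._≤ m) (sym (trans (ℤ.abs-* (+ 2) (- + k))
          (trans (cong (2 ℕ.*_) (ℤ.∣-i∣≡∣i∣ (+ k))) (cong (k ℕ.+_) (ℕ.+-identityʳ k))))) 2k≤m
    where
    r = i ℤ.%ℕ m
    k = m ℕ.∸ r
    k+r≡m : k ℕ.+ r ≡ m
    k+r≡m = ℕ.m∸n+n≡m (ℕ.<⇒≤ (ℤ.n%ℕd<d i m))
    2k≤m : k ℕ.+ k ℕ.≤ m
    2k≤m = subst (k ℕ.+ k ℕ.≤_) k+r≡m (ℕ.+-monoʳ-≤ k (ℕ.<⇒≤
      (ℕ.+-cancelʳ-< r k r (subst (ℕ._< r ℕ.+ r) (sym k+r≡m) (ℕ.≰⇒> 2r≰m)))))
    shift : ∀ r k q → r + q * (k + r) ≡ - k + (q + 1ℤ) * (k + r)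
    shift = solve-∀
    +m≡ : + m ≡ + k + + r
    +m≡ = trans (cong +_ (sym k+r≡m)) (ℤ.pos-+ k r)
    eq : i ≡ - + k + (i ℤ./ℕ m + 1ℤ) * + m
    eq = trans (ℤ.a≡a%ℕn+[a/ℕn]*n i m)
      (subst (λ n → + r + (i ℤ./ℕ m) * n ≡ - + k + (i ℤ./ℕ m + 1ℤ) * n) (sym +m≡) (shift (+ r) (+ k) (i ℤ./ℕ m)))

  -- Write A = α + m L with |2 α| ≤ m coordinatewise, and N(A) = m p, N(α) = m r.
  -- Then w = L ᾱ + r is a quaternion of norm r p, and 0 < r < m unless r = 0 or all |2 α| = m,
  -- in which case m ∣ p.
  module Descent {p : ℕ} (p-prime : Prime p) where

    open ≡-Reasoning

    private
      expand : ∀ M α β γ δ k l m n →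
        (α + k * M) * (α + k * M) + (β + l * M) * (β + l * M) + (γ + m * M) * (γ + m * M) + (δ + n * M) * (δ + n * M)
        ≡ (α * α + β * β + γ * γ + δ * δ) + M * (+ 2 * (k * α + l * β + m * γ + n * δ) + M * (k * k + l * l + m * m + n * n))
      expand = solve-∀

      norm-w : ∀ r α β γ δ k l m n → let t = k * α + l * β + m * γ + n * δ + r in
        t * t
        + (k * β - l * α + m * δ - n * γ) * (k * β - l * α + m * δ - n * γ)
        + (k * γ - l * δ - m * α + n * β) * (k * γ - l * δ - m * α + n * β)
        + (k * δ + l * γ - m * β - n * α) * (k * δ + l * γ - m * β - n * α)
        ≡ (k * k + l * l + m * m + n * n) * (α * α + β * β + γ * γ + δ * δ)
          + r * (+ 2 * (k * α + l * β + m * γ + n * δ) + r)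
      norm-w = solve-∀

      rearrange : ∀ M r T L → L * (M * r) + r * (T + r) ≡ r * (r + (T + M * L))
      rearrange = solve-∀

    descent : ∀ m .{{_ : ℕ.NonZero m}} → m ℕ.< p → SumOfFourSquares (+ m * + p) →
      + m ∣ + p ⊎ ∃ λ r → 0 ℕ.< r × r ℕ.< m × SumOfFourSquares (+ r * + p)
    descent M′ m<p (a , b , c , d , eq) with nearest a M′ | nearest b M′ | nearest c M′ | nearest d M′
    ... | α , k , refl , α-bound | β , l , refl , β-bound | γ , m , refl , γ-bound | δ , n , refl , δ-bound =
      cases (strictOr-+ (strictOr-+ (strictOr-+ (0<i*i⊎i≡0 α) (0<i*i⊎i≡0 β)) (0<i*i⊎i≡0 γ)) (0<i*i⊎i≡0 δ))
            (strictOr-+ (strictOr-+ (strictOr-+ (square-bound (+ 2 * α) M′ α-bound) (square-bound (+ 2 * β) M′ β-bound))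
              (square-bound (+ 2 * γ) M′ γ-bound)) (square-bound (+ 2 * δ) M′ δ-bound))
      where
      M P Nα NL T r : ℤ
      M = + M′
      P = + p
      Nα = α * α + β * β + γ * γ + δ * δ
      NL = k * k + l * l + m * m + n * n
      T = + 2 * (k * α + l * β + m * γ + n * δ)
      -- N(A) = M P is solved for N(α) / M: expanding N(α + M L) yields N(α) = M r without any
      -- division.
      r = P - (T + M * NL)

      Nα≡Mr : Nα ≡ M * r
      Nα≡Mr = trans (sym (drop Nα (M * (T + M * NL))))
          (trans (cong (_- M * (T + M * NL)) (trans (sym (expand M α β γ δ k l m n)) eq)) (factor M P (T + M * NL)))
        where
        drop : ∀ x y → x + y - y ≡ x
        drop = solve-∀
        factor : ∀ x y z → x * y - x * z ≡ x * (y - z)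
        factor = solve-∀

      P≡ : P ≡ r + (T + M * NL)
      P≡ = add-back P (T + M * NL)
        where
        add-back : ∀ x y → x ≡ x - y + y
        add-back = solve-∀

      instance
        M>0 : ℤ.Positive M
        M>0 = ℤ.positive (+<+ (ℕ.>-nonZero⁻¹ M′))

      ∣-0 : ∀ {i} → i ≡ 0ℤ → M ∣ i
      ∣-0 i≡0 = divides 0ℤ i≡0

      -- P = r + T + M N(L), and T is a combination of 2 α, 2 β, 2 γ, 2 δ. Divisibility of the
      -- doubled coordinates is exactly what the extreme case |2 α| = M provides.
      ∣-all : M ∣ r → M ∣ (+ 2 * α) → M ∣ (+ 2 * β) → M ∣ (+ 2 * γ) → M ∣ (+ 2 * δ) → M ∣ P
      ∣-all (divides ρ r≡) (divides q₁ α≡) (divides q₂ β≡) (divides q₃ γ≡) (divides q₄ δ≡) =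
        divides (ρ + (k * q₁ + l * q₂ + m * q₃ + n * q₄ + NL)) (begin
          P                                ≡⟨ P≡ ⟩
          r + (T + M * NL)                 ≡⟨ cong₂ (λ x y → x + (y + M * NL)) r≡ (trans (distrib α β γ δ k l m n)
                                                (cong₂ _+_ (cong₂ _+_ (cong₂ _+_ (cong (k *_) α≡) (cong (l *_) β≡))
                                                  (cong (m *_) γ≡)) (cong (n *_) δ≡))) ⟩
          ρ * M + ((k * (q₁ * M) + l * (q₂ * M) + m * (q₃ * M) + n * (q₄ * M)) + M * NL)
                                           ≡⟨ collect M ρ NL k l m n q₁ q₂ q₃ q₄ ⟩
          _                                ∎)
        where
        distrib : ∀ α β γ δ k l m n → + 2 * (k * α + l * β + m * γ + n * δ)
          ≡ k * (+ 2 * α) + l * (+ 2 * β) + m * (+ 2 * γ) + n * (+ 2 * δ)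
        distrib = solve-∀
        collect : ∀ M ρ NL k l m n q₁ q₂ q₃ q₄ →
          ρ * M + ((k * (q₁ * M) + l * (q₂ * M) + m * (q₃ * M) + n * (q₄ * M)) + M * NL)
          ≡ (ρ + (k * q₁ + l * q₂ + m * q₃ + n * q₄ + NL)) * M
        collect = solve-∀

      smaller : 0ℤ < Nα → r < M → ∃ λ r → 0 ℕ.< r × r ℕ.< M′ × SumOfFourSquares (+ r * P)
      smaller 0<Nα r<M = ∣ r ∣ , ℤ.drop‿+<+ (subst (0ℤ <_) (sym +∣r∣≡r) 0<r) ,
        ℤ.drop‿+<+ (subst (_< M) (sym +∣r∣≡r) r<M) ,
        subst (λ i → SumOfFourSquares (i * P)) (sym +∣r∣≡r) 
          ( k * α + l * β + m * γ + n * δ + r , k * β - l * α + m * δ - n * γ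
          , k * γ - l * δ - m * α + n * β , k * δ + l * γ - m * β - n * α , (begin
          _                                                         ≡⟨ norm-w r α β γ δ k l m n ⟩
          NL * Nα + r * (T + r)                                     ≡⟨ cong (λ x → NL * x + r * (T + r)) Nα≡Mr ⟩
          NL * (M * r) + r * (T + r)                                ≡⟨ rearrange M r T NL ⟩
          r * (r + (T + M * NL))                                    ≡⟨ cong (r *_) P≡ ⟨
          r * P                                                     ∎))
        where
        0<r : 0ℤ < r
        0<r = ℤ.*-cancelˡ-<-nonNeg M (subst₂ _<_ (sym (ℤ.*-zeroʳ M)) Nα≡Mr 0<Nα)
        +∣r∣≡r : + ∣ r ∣ ≡ r
        +∣r∣≡r = ℤ.0≤i⇒+∣i∣≡i (ℤ.<⇒≤ 0<r)

      X≡ : (+ 2 * α) * (+ 2 * α) + (+ 2 * β) * (+ 2 * β) + (+ 2 * γ) * (+ 2 * γ) + (+ 2 * δ) * (+ 2 * δ) ≡ M * (+ 4 * r)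
      X≡ = trans (4× α β γ δ) (trans (cong (+ 4 *_) Nα≡Mr) (swap M r))
        where
        4× : ∀ α β γ δ → (+ 2 * α) * (+ 2 * α) + (+ 2 * β) * (+ 2 * β) + (+ 2 * γ) * (+ 2 * γ) + (+ 2 * δ) * (+ 2 * δ)
          ≡ + 4 * (α * α + β * β + γ * γ + δ * δ)
        4× = solve-∀
        swap : ∀ x y → + 4 * (x * y) ≡ x * (+ 4 * y)
        swap = solve-∀

      4MM : ∀ x → x * x + x * x + x * x + x * x ≡ x * (+ 4 * x)
      4MM = solve-∀

      cases : StrictOr (0ℤ + 0ℤ + 0ℤ + 0ℤ) Nα (((α ≡ 0ℤ × β ≡ 0ℤ) × γ ≡ 0ℤ) × δ ≡ 0ℤ) →
        StrictOr ((+ 2 * α) * (+ 2 * α) + (+ 2 * β) * (+ 2 * β) + (+ 2 * γ) * (+ 2 * γ) + (+ 2 * δ) * (+ 2 * δ))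
          (M * M + M * M + M * M + M * M) ((((M ∣ (+ 2 * α)) × (M ∣ (+ 2 * β))) × (M ∣ (+ 2 * γ))) × (M ∣ (+ 2 * δ))) →
        M ∣ P ⊎ ∃ λ r → 0 ℕ.< r × r ℕ.< M′ × SumOfFourSquares (+ r * P)
      cases (_ , inj₂ (((α≡0 , β≡0) , γ≡0) , δ≡0)) _ = inj₁ (∣-all (∣-0 r≡0)
        (∣-0 (cong (+ 2 *_) α≡0)) (∣-0 (cong (+ 2 *_) β≡0)) (∣-0 (cong (+ 2 *_) γ≡0)) (∣-0 (cong (+ 2 *_) δ≡0)))
        where
        Nα≡0 : Nα ≡ 0ℤ
        Nα≡0 = cong₂ _+_ (cong₂ _+_ (cong₂ _+_ (cong₂ _*_ α≡0 α≡0) (cong₂ _*_ β≡0 β≡0)) (cong₂ _*_ γ≡0 γ≡0)) (cong₂ _*_ δ≡0 δ≡0)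
        r≡0 : r ≡ 0ℤ
        r≡0 = ℤ.*-cancelˡ-≡ M r 0ℤ (trans (sym Nα≡Mr) (trans Nα≡0 (sym (ℤ.*-zeroʳ M))))
      -- The doubled coordinates have square sum 4 M r, which is less than 4 M²; cancelling 4 M
      -- leaves r < M.
      cases (_ , inj₁ 0<Nα) (_ , inj₁ X<) = inj₂ (smaller 0<Nα
        (ℤ.*-cancelˡ-<-nonNeg (+ 4) (ℤ.*-cancelˡ-<-nonNeg M (subst₂ _<_ X≡ (4MM M) X<))))
      cases (_ , inj₁ 0<Nα) (X≤ , inj₂ (((α∣ , β∣) , γ∣) , δ∣)) with r ℤ.<? M
      ... | yes r<M = inj₂ (smaller 0<Nα r<M)
      -- The weak bound still gives r ≤ M, so r = M, and M divides both r and all the doubled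
      -- coordinates.
      ... | no r≮M = inj₁ (∣-all (divides 1ℤ (trans r≡M (sym (ℤ.*-identityˡ M)))) α∣ β∣ γ∣ δ∣)
        where
        r≡M : r ≡ M
        r≡M = ℤ.≤-antisym (ℤ.*-cancelˡ-≤-pos r M (+ 4) (ℤ.*-cancelˡ-≤-pos (+ 4 * r) (+ 4 * M) M
          (subst₂ _≤_ X≡ (4MM M) X≤))) (ℤ.≮⇒≥ r≮M)

    SumOfFourSquares-descent : ∀ m → Acc ℕ._<_ m → 0 ℕ.< m → m ℕ.< p → SumOfFourSquares (+ m * + p) → SumOfFourSquares (+ p)
    SumOfFourSquares-descent m (acc rec) 0<m m<p m-squares with descent m {{ℕ.>-nonZero 0<m}} m<p m-squares
    ... | inj₂ (r , 0<r , r<m , r-squares) = SumOfFourSquares-descent r (rec r<m) 0<r (ℕ.<-trans r<m m<p) r-squares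
    -- A divisor of p below p is 1, and then the representation of m p is already one of p.
    ... | inj₁ m∣p with prime⇒irreducible p-prime (∣⇒∣ᵤ m∣p)
    ...   | inj₁ refl = subst SumOfFourSquares (ℤ.*-identityˡ (+ p)) m-squares
    ...   | inj₂ m≡p = contradiction m≡p (ℕ.<⇒≢ m<p)

    -- A multiple of p of the form 1 + a² + b².

    private
      instance
        p≢0 : ℕ.NonZero p
        p≢0 = prime⇒nonZero p-prime

      -- Rounding down gives 2 h ≤ p < 2 h + 2 for odd p and for p = 2 alike, so the prime 2 is no
      -- separate case.
      h : ℕ
      h = p ℕ./ 2

      2h≤p : h ℕ.+ h ℕ.≤ p
      2h≤p = subst (ℕ._≤ p) (trans (ℕ.*-comm h 2) (cong (h ℕ.+_) (ℕ.+-identityʳ h))) (ℕ.m/n*n≤m p 2)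

      p<2h+2 : p ℕ.< suc h ℕ.+ suc h
      p<2h+2 = subst₂ ℕ._<_ (sym (ℕ.m≡m%n+[m/n]*n p 2)) (cong suc (trans (cong suc
          (trans (ℕ.*-comm h 2) (cong (h ℕ.+_) (ℕ.+-identityʳ h)))) (sym (ℕ.+-suc h h))))
        (ℕ.+-monoˡ-< (h ℕ.* 2) (ℕ.m%n<n p 2))

      residue : ℤ → Fin p
      residue i = fromℕ< (ℤ.n%ℕd<d i p)

      residue-≡ : ∀ i j → residue i ≡ residue j → + p ∣ i - j
      residue-≡ i j eq = divides (i ℤ./ℕ p - j ℤ./ℕ p) (begin
        i - j  ≡⟨ cong₂ _-_ (ℤ.a≡a%ℕn+[a/ℕn]*n i p) (ℤ.a≡a%ℕn+[a/ℕn]*n j p) ⟩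
        (+ (i ℤ.%ℕ p) + i ℤ./ℕ p * + p) - (+ (j ℤ.%ℕ p) + j ℤ./ℕ p * + p)
               ≡⟨ cong (λ n → (+ n + i ℤ./ℕ p * + p) - (+ (j ℤ.%ℕ p) + j ℤ./ℕ p * + p))
                    (Fin.fromℕ<-injective _ _ (ℤ.n%ℕd<d i p) (ℤ.n%ℕd<d j p) eq) ⟩
        (+ (j ℤ.%ℕ p) + i ℤ./ℕ p * + p) - (+ (j ℤ.%ℕ p) + j ℤ./ℕ p * + p)
               ≡⟨ cancel (+ (j ℤ.%ℕ p)) (i ℤ./ℕ p) (j ℤ./ℕ p) (+ p) ⟩
        (i ℤ./ℕ p - j ℤ./ℕ p) * + p ∎)
        where
        cancel : ∀ r x y p → (r + x * p) - (r + y * p) ≡ (x - y) * p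
        cancel = solve-∀

      square : ℕ → ℤ
      square n = + n * + n

      -- n² - m² = (n - m) (m + n), and both factors are positive and smaller than p because m < n ≤
      -- h and 2 h ≤ p. Euclid's lemma then excludes divisibility.
      squares-distinct-< : ∀ {m n} → m ℕ.< n → n ℕ.≤ h → ¬ (+ p ∣ square n - square m)
      squares-distinct-< {m} {n} m<n n≤h p∣ with euclidsLemma k (m ℕ.+ n) p-prime
          (subst (p ℕ.∣_) (cong ∣_∣ difference) (∣⇒∣ᵤ p∣))
        where
        k : ℕ
        k = n ℕ.∸ m
        difference : square n - square m ≡ + (k ℕ.* (m ℕ.+ n))
        difference = begin
          square n - square m                     ≡⟨ cong (λ i → square i - square m) n≡ ⟩
          square (k ℕ.+ m) - square m             ≡⟨ cong (λ i → i * i - square m) (ℤ.pos-+ k m) ⟩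
          (+ k + + m) * (+ k + + m) - square m    ≡⟨ factor (+ k) (+ m) ⟩
          + k * (+ m + (+ k + + m))               ≡⟨ cong (λ i → + k * (+ m + i)) (ℤ.pos-+ k m) ⟨
          + k * (+ m + + (k ℕ.+ m))               ≡⟨ cong (λ i → + k * (+ m + + i)) n≡ ⟨
          + k * (+ m + + n)                       ≡⟨ cong (+ k *_) (ℤ.pos-+ m n) ⟨
          + k * + (m ℕ.+ n)                       ≡⟨ ℤ.pos-* k (m ℕ.+ n) ⟨
          + (k ℕ.* (m ℕ.+ n))                     ∎
          where
          n≡ : n ≡ k ℕ.+ m
          n≡ = sym (ℕ.m∸n+n≡m (ℕ.<⇒≤ m<n))
          factor : ∀ k m → (k + m) * (k + m) - m * m ≡ k * (m + (k + m))
          factor = solve-∀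
      ... | inj₁ p∣k = ℕ.>⇒∤ {{ℕ.>-nonZero (ℕ.m<n⇒0<n∸m m<n)}} (ℕ.≤-<-trans (ℕ.m∸n≤m n m) n<p) p∣k
        where
        n<p : n ℕ.< p
        n<p = ℕ.<-≤-trans (ℕ.m<m+n n (ℕ.≤-<-trans ℕ.z≤n m<n)) (ℕ.≤-trans (ℕ.+-mono-≤ n≤h n≤h) 2h≤p)
      ... | inj₂ p∣m+n = ℕ.>⇒∤ {{ℕ.>-nonZero (ℕ.<-≤-trans (ℕ.≤-<-trans ℕ.z≤n m<n) (ℕ.m≤n+m n m))}}
          (ℕ.<-≤-trans (ℕ.+-monoˡ-< n m<n) (ℕ.≤-trans (ℕ.+-mono-≤ n≤h n≤h) 2h≤p)) p∣m+n

      ∣-flip : ∀ i j → + p ∣ i - j → + p ∣ j - i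
      ∣-flip i j (divides q eq) = divides (- q) (trans (flip i j) (trans (cong -_ eq) (ℤ.neg-distribˡ-* q (+ p))))
        where
        flip : ∀ i j → j - i ≡ - (i - j)
        flip = solve-∀

      squares-distinct : ∀ (i j : Fin (suc h)) → + p ∣ square (toℕ i) - square (toℕ j) → i ≡ j
      squares-distinct i j p∣ with ℕ.<-cmp (toℕ i) (toℕ j)
      ... | tri< i<j _ _ = contradiction (∣-flip (square (toℕ i)) (square (toℕ j)) p∣) (squares-distinct-< i<j (ℕ.s≤s⁻¹ (Fin.toℕ<n j)))
      ... | tri≈ _ i≡j _ = Fin.toℕ-injective i≡j
      ... | tri> _ _ j<i = contradiction p∣ (squares-distinct-< j<i (ℕ.s≤s⁻¹ (Fin.toℕ<n i)))

      -- These 2 h + 2 > p integers cannot have distinct residues modulo p.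
      candidate : Fin (suc h) ⊎ Fin (suc h) → ℤ
      candidate = [ (λ i → square (toℕ i)) , (λ j → -1ℤ - square (toℕ j)) ]′

      -- Within one family, congruent candidates coincide because the squares are distinct modulo p.
      -- A collision between the families says i² ≡ -1 - j².
      collision : ∀ (x y : Fin (suc h) ⊎ Fin (suc h)) → + p ∣ candidate x - candidate y →
        x ≡ y ⊎ ∃ λ (i : Fin (suc h)) → ∃ λ (j : Fin (suc h)) → + p ∣ (1ℤ + square (toℕ i) + square (toℕ j))
      collision (inj₁ i) (inj₁ j) p∣ = inj₁ (cong inj₁ (squares-distinct i j p∣))
      collision (inj₁ i) (inj₂ j) p∣ = inj₂ (i , j , subst (+ p ∣_) (eq (square (toℕ i)) (square (toℕ j))) p∣)
        where
        eq : ∀ x y → x - (-1ℤ - y) ≡ 1ℤ + x + y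
        eq = solve-∀
      collision (inj₂ i) (inj₁ j) p∣ with collision (inj₁ j) (inj₂ i) (∣-flip (candidate (inj₂ i)) (candidate (inj₁ j)) p∣)
      ... | inj₂ r = inj₂ r
      collision (inj₂ i) (inj₂ j) p∣ = inj₁ (cong inj₂ (sym (squares-distinct j i
        (subst (+ p ∣_) (eq (square (toℕ i)) (square (toℕ j))) p∣))))
        where
        eq : ∀ x y → (-1ℤ - x) - (-1ℤ - y) ≡ y - x
        eq = solve-∀

      splitAt-injective : ∀ {m n} {i j : Fin (m ℕ.+ n)} → splitAt m i ≡ splitAt m j → i ≡ j
      splitAt-injective {m} {n} {i} {j} eq =
        trans (sym (Fin.join-splitAt m n i)) (trans (cong (join m n) eq) (Fin.join-splitAt m n j))

      1+a²+b²≡ : ∀ a b → 1ℤ + square a + square b ≡ + (1 ℕ.+ a ℕ.* a ℕ.+ b ℕ.* b)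
      1+a²+b²≡ a b = sym (trans (ℤ.pos-+ (1 ℕ.+ a ℕ.* a) (b ℕ.* b))
        (cong₂ _+_ (trans (ℤ.pos-+ 1 (a ℕ.* a)) (cong (λ i → 1ℤ + i) (ℤ.pos-* a a))) (ℤ.pos-* b b)))

    ∃-p∣1+i²+j² : ∃ λ (i : Fin (suc h)) → ∃ λ (j : Fin (suc h)) → + p ∣ (1ℤ + square (toℕ i) + square (toℕ j))
    ∃-p∣1+i²+j² = let i , j , i<j , eq = Fin.pigeonhole p<2h+2 (residue ∘ candidate ∘ splitAt (suc h)) in
      [ (λ i≡j → contradiction (splitAt-injective {suc h} i≡j) (Fin.<⇒≢ i<j)) , id ]′
        (collision (splitAt (suc h) i) (splitAt (suc h) j)
          (residue-≡ (candidate (splitAt (suc h) i)) (candidate (splitAt (suc h) j)) eq))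

    private
      multiple-SumOfFourSquares : ∀ {a b} → a ℕ.≤ h → b ℕ.≤ h → p ℕ.∣ 1 ℕ.+ a ℕ.* a ℕ.+ b ℕ.* b → SumOfFourSquares (+ p)
      multiple-SumOfFourSquares {a} {b} a≤h b≤h (ℕ.divides m@(suc _) 1+a²+b²≡mp) =
        SumOfFourSquares-descent m (<-wellFounded m) (ℕ.s≤s ℕ.z≤n) m<p
          (1ℤ , + a , + b , 0ℤ , (begin
            1ℤ + + a * + a + + b * + b + 0ℤ   ≡⟨ ℤ.+-identityʳ _ ⟩
            1ℤ + + a * + a + + b * + b        ≡⟨ 1+a²+b²≡ a b ⟩
            + (1 ℕ.+ a ℕ.* a ℕ.+ b ℕ.* b)     ≡⟨ cong +_ 1+a²+b²≡mp ⟩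
            + (m ℕ.* p)                       ≡⟨ ℤ.pos-* m p ⟩
            + m * + p                         ∎))
        where
        1<p : 1 ℕ.< p
        1<p = ℕ.nonTrivial⇒n>1 p {{prime⇒nonTrivial p-prime}}
        h<p : h ℕ.< p
        h<p = ℕ.m/n<m p 2 (ℕ.s≤s (ℕ.s≤s ℕ.z≤n))
        m<p : m ℕ.< p
        -- m p = 1 + a² + b² ≤ 1 + 2 h² ≤ 1 + h p < (h + 1) p ≤ p².
        m<p = ℕ.*-cancelʳ-< p m p (subst (ℕ._< p ℕ.* p) 1+a²+b²≡mp (ℕ.≤-<-trans
          (ℕ.s≤s (ℕ.≤-trans (ℕ.+-mono-≤ (ℕ.*-mono-≤ a≤h a≤h) (ℕ.*-mono-≤ b≤h b≤h))
            (ℕ.≤-trans (ℕ.≤-reflexive (sym (ℕ.*-distribˡ-+ h h h))) (ℕ.*-monoʳ-≤ h 2h≤p))))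
          (ℕ.<-≤-trans (ℕ.+-monoˡ-< (h ℕ.* p) 1<p) (ℕ.*-monoˡ-≤ p {suc h} {p} h<p))))

    prime-SumOfFourSquares : SumOfFourSquares (+ p)
    prime-SumOfFourSquares = let i , j , p∣ = ∃-p∣1+i²+j² in
      multiple-SumOfFourSquares (ℕ.s≤s⁻¹ (Fin.toℕ<n i)) (ℕ.s≤s⁻¹ (Fin.toℕ<n j))
        (subst (p ℕ.∣_) (cong ∣_∣ (1+a²+b²≡ (toℕ i) (toℕ j))) (∣⇒∣ᵤ p∣))

  product-SumOfFourSquares : ∀ {ps} → All Prime ps → SumOfFourSquares (+ product ps)
  product-SumOfFourSquares [] = 1ℤ , 0ℤ , 0ℤ , 0ℤ , refl
  product-SumOfFourSquares {p ∷ ps} (p-prime ∷ ps-prime) = subst SumOfFourSquares (sym (ℤ.pos-* p (product ps)))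
    (SumOfFourSquares-* (Descent.prime-SumOfFourSquares p-prime) (product-SumOfFourSquares ps-prime))

  lagrange : ∀ n .{{_ : ℕ.NonZero n}} → SumOfFourSquares (+ n)
  lagrange n with factorise n
  ... | record { isFactorisation = refl ; factorsPrime = ps } = product-SumOfFourSquares ps

  -- Bézout relations and unimodular vectors.

  private
    unit : ∀ i → ∃ λ ε → + ∣ i ∣ ≡ ε * i
    unit i with ℤ.+∣i∣≡i⊎+∣i∣≡-i i
    ... | inj₁ eq = 1ℤ , trans eq (sym (ℤ.*-identityˡ i))
    ... | inj₂ eq = -1ℤ , trans eq (sym (ℤ.-1*i≡-i i))

    bezout-pos : ∀ {g m n} → Bézout.Identity.Identity g m n → ∃ λ u → ∃ λ v → u * + m + v * + n ≡ + g
    bezout-pos {g} {m} {n} (Bézout.Identity.+- x y eq) = + x , - + y , difference {x} {m} {y} {n} eq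
      where
      add-cancel : ∀ g y n → g + y * n + - y * n ≡ g
      add-cancel = solve-∀
      difference : ∀ {x m y n} → g ℕ.+ y ℕ.* n ≡ x ℕ.* m → + x * + m + - + y * + n ≡ + g
      difference {x} {m} {y} {n} eq = trans (cong (_+ - + y * + n) (trans (sym (ℤ.pos-* x m)) (trans (cong +_ (sym eq))
        (trans (ℤ.pos-+ g (y ℕ.* n)) (cong (λ i → + g + i) (ℤ.pos-* y n)))))) (add-cancel (+ g) (+ y) (+ n))
    bezout-pos {g} {m} {n} (Bézout.Identity.-+ x y eq) with bezout-pos (Bézout.Identity.+- {g} {n} {m} y x eq)
    ... | u , v , eq′ = v , u , trans (ℤ.+-comm (v * + m) (u * + n)) eq′

  bezout : ∀ i j → ∃ λ (g : ℕ) → ∃ λ u → ∃ λ v → u * i + v * j ≡ + g × (+ g ∣ i) × (+ g ∣ j)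
  bezout i j with Bézout.lemma ∣ i ∣ ∣ j ∣
  ... | Bézout.result g isGcd identity with unit i | unit j | bezout-pos identity
  ... | ε , εi | η , ηj | u , v , eq = g , u * ε , v * η , trans (cong₂ _+_
      (trans (ℤ.*-assoc u ε i) (cong (u *_) (sym εi))) (trans (ℤ.*-assoc v η j) (cong (v *_) (sym ηj)))) eq ,
      ∣ᵤ⇒∣ (GCD.gcd∣m isGcd) , ∣ᵤ⇒∣ (GCD.gcd∣n isGcd)

  -- The number `k` is a gcd of the gcds of the pairs (a, b) and (c, d), hence divides all four
  -- entries; k² then divides n, and composing the three Bézout relations yields the coefficients.
  unimodular : ∀ {n} a b c d → SquareFree n → a * a + b * b + c * c + d * d ≡ - n →
    ∃ λ s → ∃ λ t → ∃ λ u → ∃ λ v → s * a + t * b + u * c + v * d ≡ 1ℤ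
  unimodular {n} a b c d n-sqfree eq with bezout a b | bezout c d
  ... | g , s , t , g≡ , g∣a , g∣b | h , u , v , h≡ , h∣c , h∣d with bezout (+ g) (+ h)
  ...   | k , x , y , k≡ , k∣g , k∣h = x * s , x * t , y * u , y * v , (begin
          x * s * a + x * t * b + y * u * c + y * v * d      ≡⟨ regroup x y s t u v a b c d ⟩
          x * (s * a + t * b) + y * (u * c + v * d)          ≡⟨ cong₂ (λ i j → x * i + y * j) g≡ h≡ ⟩
          x * + g + y * + h                                  ≡⟨ k≡ ⟩
          + k                                                ≡⟨ cong +_ (n-sqfree k k²∣n) ⟩
          1ℤ                                                 ∎)
      where
      open ≡-Reasoning
      regroup : ∀ x y s t u v a b c d → x * s * a + x * t * b + y * u * c + y * v * d
        ≡ x * (s * a + t * b) + y * (u * c + v * d)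
      regroup = solve-∀
      divides-squares : ∀ {a b c d} → + k ∣ a → + k ∣ b → + k ∣ c → + k ∣ d →
        + k * + k ∣ (a * a + b * b + c * c + d * d)
      divides-squares (divides p refl) (divides q refl) (divides r refl) (divides s refl) =
        divides (p * p + q * q + r * r + s * s) (factor (+ k) p q r s)
        where
        factor : ∀ k p q r s → p * k * (p * k) + q * k * (q * k) + r * k * (r * k) + s * k * (s * k)
          ≡ (p * p + q * q + r * r + s * s) * (k * k)
        factor = solve-∀
      k²∣n : k ℕ.* k ℕ.∣ ∣ n ∣
      k²∣n = subst₂ ℕ._∣_ (ℤ.abs-* (+ k) (+ k)) (trans (cong ∣_∣ eq) (ℤ.∣-i∣≡∣i∣ n)) (∣⇒∣ᵤ (divides-squares
        (∣-trans k∣g g∣a) (∣-trans k∣g g∣b) (∣-trans k∣h h∣c) (∣-trans k∣h h∣d)))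

open FourSquares using (lagrange; unimodular)

-- Rational identities for the coordinates of K.

ℚ-ring : AlmostCommutativeRing 0ℓ 0ℓ
ℚ-ring = fromCommutativeRing ℚ.+-*-commutativeRing (λ x → dec⇒maybe (0ℚ ℚ.≟ x))

module _ where
  open import Data.Rational using (_+_; _*_)
  open import Tactic.RingSolver using (solve-∀)

  -- The comparison takes place among unnormalised fractions, where the denominators are visibly 1
  -- and no reduction by a gcd intervenes.
  /1-homo-+ : ∀ i j → (i ℤ.+ j) ℚ./ 1 ≡ i ℚ./ 1 + j ℚ./ 1
  /1-homo-+ i j = ℚ.toℚᵘ-injective (ℚᵘ.≃-trans (ℚ.toℚᵘ-fromℚᵘ (mkℚᵘ (i ℤ.+ j) 0))
    (ℚᵘ.≃-sym (ℚᵘ.≃-trans (ℚ.toℚᵘ-homo-+ (i ℚ./ 1) (j ℚ./ 1))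
      (ℚᵘ.≃-trans (ℚᵘ.+-cong (ℚ.toℚᵘ-fromℚᵘ (mkℚᵘ i 0)) (ℚ.toℚᵘ-fromℚᵘ (mkℚᵘ j 0)))
        (*≡* (cong (ℤ._* ℤ.1ℤ) (cong₂ ℤ._+_ (ℤ.*-identityʳ i) (ℤ.*-identityʳ j))))))))

  /1-homo-* : ∀ i j → (i ℤ.* j) ℚ./ 1 ≡ (i ℚ./ 1) * (j ℚ./ 1)
  /1-homo-* i j = ℚ.toℚᵘ-injective (ℚᵘ.≃-trans (ℚ.toℚᵘ-fromℚᵘ (mkℚᵘ (i ℤ.* j) 0))
    (ℚᵘ.≃-sym (ℚᵘ.≃-trans (ℚ.toℚᵘ-homo-* (i ℚ./ 1) (j ℚ./ 1))
        (ℚᵘ.*-cong (ℚ.toℚᵘ-fromℚᵘ (mkℚᵘ i 0)) (ℚ.toℚᵘ-fromℚᵘ (mkℚᵘ j 0))))))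

  /1-homo-neg : ∀ i → (ℤ.- i) ℚ./ 1 ≡ ℚ.- (i ℚ./ 1)
  /1-homo-neg i = ℚ.toℚᵘ-injective (ℚᵘ.≃-trans (ℚ.toℚᵘ-fromℚᵘ (mkℚᵘ (ℤ.- i) 0))
    (ℚᵘ.≃-sym (ℚᵘ.≃-trans (ℚ.toℚᵘ-homo‿- (i ℚ./ 1)) (ℚᵘ.-‿cong (ℚ.toℚᵘ-fromℚᵘ (mkℚᵘ i 0))))))

  assoc₀ : ∀ a b x0 x1 x2 x3 y0 y1 y2 y3 z0 z1 z2 z3 →
    (x0 * y0 + a * x1 * y1 + b * x2 * y2 + a * b * x3 * y3) * z0
      + a * (x0 * y1 + x1 * y0 + b * (x2 * y3 + x3 * y2)) * z1
      + b * (x0 * y2 + x2 * y0 + a * (x1 * y3 + x3 * y1)) * z2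
      + a * b * (x0 * y3 + x3 * y0 + x1 * y2 + x2 * y1) * z3
    ≡ x0 * (y0 * z0 + a * y1 * z1 + b * y2 * z2 + a * b * y3 * z3)
      + a * x1 * (y0 * z1 + y1 * z0 + b * (y2 * z3 + y3 * z2))
      + b * x2 * (y0 * z2 + y2 * z0 + a * (y1 * z3 + y3 * z1))
      + a * b * x3 * (y0 * z3 + y3 * z0 + y1 * z2 + y2 * z1)
  assoc₀ = solve-∀ ℚ-ring

  assoc₁ : ∀ a b x0 x1 x2 x3 y0 y1 y2 y3 z0 z1 z2 z3 →
    (x0 * y0 + a * x1 * y1 + b * x2 * y2 + a * b * x3 * y3) * z1
      + (x0 * y1 + x1 * y0 + b * (x2 * y3 + x3 * y2)) * z0
      + b * ((x0 * y2 + x2 * y0 + a * (x1 * y3 + x3 * y1)) * z3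
      + (x0 * y3 + x3 * y0 + x1 * y2 + x2 * y1) * z2)
    ≡ x0 * (y0 * z1 + y1 * z0 + b * (y2 * z3 + y3 * z2))
      + x1 * (y0 * z0 + a * y1 * z1 + b * y2 * z2 + a * b * y3 * z3)
      + b * (x2 * (y0 * z3 + y3 * z0 + y1 * z2 + y2 * z1)
      + x3 * (y0 * z2 + y2 * z0 + a * (y1 * z3 + y3 * z1)))
  assoc₁ = solve-∀ ℚ-ring

  -- Exchanging √a and √b in `assoc₁` would give this only up to the order of the terms in the
  -- products of coordinate zero, so it is a separate identity.
  assoc₂ : ∀ a b x0 x1 x2 x3 y0 y1 y2 y3 z0 z1 z2 z3 →
    (x0 * y0 + a * x1 * y1 + b * x2 * y2 + a * b * x3 * y3) * z2
      + (x0 * y2 + x2 * y0 + a * (x1 * y3 + x3 * y1)) * z0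
      + a * ((x0 * y1 + x1 * y0 + b * (x2 * y3 + x3 * y2)) * z3
      + (x0 * y3 + x3 * y0 + x1 * y2 + x2 * y1) * z1)
    ≡ x0 * (y0 * z2 + y2 * z0 + a * (y1 * z3 + y3 * z1))
      + x2 * (y0 * z0 + a * y1 * z1 + b * y2 * z2 + a * b * y3 * z3)
      + a * (x1 * (y0 * z3 + y3 * z0 + y1 * z2 + y2 * z1)
      + x3 * (y0 * z1 + y1 * z0 + b * (y2 * z3 + y3 * z2)))
  assoc₂ = solve-∀ ℚ-ring

  assoc₃ : ∀ a b x0 x1 x2 x3 y0 y1 y2 y3 z0 z1 z2 z3 →
    (x0 * y0 + a * x1 * y1 + b * x2 * y2 + a * b * x3 * y3) * z3
      + (x0 * y3 + x3 * y0 + x1 * y2 + x2 * y1) * z0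
      + (x0 * y1 + x1 * y0 + b * (x2 * y3 + x3 * y2)) * z2
      + (x0 * y2 + x2 * y0 + a * (x1 * y3 + x3 * y1)) * z1
    ≡ x0 * (y0 * z3 + y3 * z0 + y1 * z2 + y2 * z1)
      + x3 * (y0 * z0 + a * y1 * z1 + b * y2 * z2 + a * b * y3 * z3)
      + x1 * (y0 * z2 + y2 * z0 + a * (y1 * z3 + y3 * z1))
      + x2 * (y0 * z1 + y1 * z0 + b * (y2 * z3 + y3 * z2))
  assoc₃ = solve-∀ ℚ-ring

  distrib₀ : ∀ a b x0 x1 x2 x3 y0 y1 y2 y3 z0 z1 z2 z3 →
    x0 * (y0 + z0) + a * x1 * (y1 + z1) + b * x2 * (y2 + z2) + a * b * x3 * (y3 + z3)
    ≡ x0 * y0 + a * x1 * y1 + b * x2 * y2 + a * b * x3 * y3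
      + (x0 * z0 + a * x1 * z1 + b * x2 * z2 + a * b * x3 * z3)
  distrib₀ = solve-∀ ℚ-ring

  -- It serves the coordinate of √b as well, with a in the place of b and the indices 1 and 2
  -- exchanged; `comm₁` and `scalar₁` are used in the same way.
  distrib₁ : ∀ b x0 x1 x2 x3 y0 y1 y2 y3 z0 z1 z2 z3 →
    x0 * (y1 + z1) + x1 * (y0 + z0) + b * (x2 * (y3 + z3) + x3 * (y2 + z2))
    ≡ x0 * y1 + x1 * y0 + b * (x2 * y3 + x3 * y2)
      + (x0 * z1 + x1 * z0 + b * (x2 * z3 + x3 * z2))
  distrib₁ = solve-∀ ℚ-ring

  distrib₃ : ∀ x0 x1 x2 x3 y0 y1 y2 y3 z0 z1 z2 z3 →
    x0 * (y3 + z3) + x3 * (y0 + z0) + x1 * (y2 + z2) + x2 * (y1 + z1)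
    ≡ x0 * y3 + x3 * y0 + x1 * y2 + x2 * y1
      + (x0 * z3 + x3 * z0 + x1 * z2 + x2 * z1)
  distrib₃ = solve-∀ ℚ-ring

  comm₀ : ∀ a b x0 x1 x2 x3 y0 y1 y2 y3 →
    x0 * y0 + a * x1 * y1 + b * x2 * y2 + a * b * x3 * y3
    ≡ y0 * x0 + a * y1 * x1 + b * y2 * x2 + a * b * y3 * x3
  comm₀ = solve-∀ ℚ-ring

  comm₁ : ∀ b x0 x1 x2 x3 y0 y1 y2 y3 →
    x0 * y1 + x1 * y0 + b * (x2 * y3 + x3 * y2) ≡ y0 * x1 + y1 * x0 + b * (y2 * x3 + y3 * x2)
  comm₁ = solve-∀ ℚ-ring

  comm₃ : ∀ x0 x1 x2 x3 y0 y1 y2 y3 →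
    x0 * y3 + x3 * y0 + x1 * y2 + x2 * y1 ≡ y0 * x3 + y3 * x0 + y1 * x2 + y2 * x1
  comm₃ = solve-∀ ℚ-ring

  scalar₀ : ∀ a b k x0 x1 x2 x3 → k * x0 + a * 0ℚ * x1 + b * 0ℚ * x2 + a * b * 0ℚ * x3 ≡ k * x0
  scalar₀ = solve-∀ ℚ-ring

  scalar₁ : ∀ b k x0 x1 x2 x3 → k * x1 + 0ℚ * x0 + b * (0ℚ * x3 + 0ℚ * x2) ≡ k * x1
  scalar₁ = solve-∀ ℚ-ring

  scalar₃ : ∀ k x0 x1 x2 x3 → k * x3 + 0ℚ * x0 + 0ℚ * x2 + 0ℚ * x1 ≡ k * x3
  scalar₃ = solve-∀ ℚ-ring

  √a-square₀ : ∀ a b → 0ℚ * 0ℚ + a * 1ℚ * 1ℚ + b * 0ℚ * 0ℚ + a * b * 0ℚ * 0ℚ ≡ a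
  √a-square₀ = solve-∀ ℚ-ring

  √b-square₀ : ∀ a b → 0ℚ * 0ℚ + a * 0ℚ * 0ℚ + b * 1ℚ * 1ℚ + a * b * 0ℚ * 0ℚ ≡ b
  √b-square₀ = solve-∀ ℚ-ring

  √a-square₁ : ∀ b → 0ℚ * 1ℚ + 1ℚ * 0ℚ + b * (0ℚ * 0ℚ + 0ℚ * 0ℚ) ≡ 0ℚ
  √a-square₁ = solve-∀ ℚ-ring

  √a-square₂ : ∀ a → 0ℚ * 0ℚ + 0ℚ * 0ℚ + a * (1ℚ * 0ℚ + 0ℚ * 1ℚ) ≡ 0ℚ
  √a-square₂ = solve-∀ ℚ-ring

K-≡ : ∀ {x0 x1 x2 x3 y0 y1 y2 y3} → x0 ≡ y0 → x1 ≡ y1 → x2 ≡ y2 → x3 ≡ y3 →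
  ⟨ x0 , x1 , x2 , x3 ⟩ ≡ ⟨ y0 , y1 , y2 , y3 ⟩
K-≡ refl refl refl refl = refl

-- The ring structure of K and the transfer of the result.

module Field (a b : ℤ) where
  open Arith a b

  -K_ : K → K
  -K ⟨ x0 , x1 , x2 , x3 ⟩ = ⟨ ℚ.- x0 , ℚ.- x1 , ℚ.- x2 , ℚ.- x3 ⟩

  private
    qa qb : ℚ
    qa = a ℚ./ 1
    qb = b ℚ./ 1

  *K-assoc : ∀ x y z → (x *K y) *K z ≡ x *K (y *K z)
  *K-assoc ⟨ x0 , x1 , x2 , x3 ⟩ ⟨ y0 , y1 , y2 , y3 ⟩ ⟨ z0 , z1 , z2 , z3 ⟩ = K-≡
    (assoc₀ qa qb x0 x1 x2 x3 y0 y1 y2 y3 z0 z1 z2 z3)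
    (assoc₁ qa qb x0 x1 x2 x3 y0 y1 y2 y3 z0 z1 z2 z3)
    (assoc₂ qa qb x0 x1 x2 x3 y0 y1 y2 y3 z0 z1 z2 z3)
    (assoc₃ qa qb x0 x1 x2 x3 y0 y1 y2 y3 z0 z1 z2 z3)

  *K-comm : ∀ x y → x *K y ≡ y *K x
  *K-comm ⟨ x0 , x1 , x2 , x3 ⟩ ⟨ y0 , y1 , y2 , y3 ⟩ = K-≡
    (comm₀ qa qb x0 x1 x2 x3 y0 y1 y2 y3)
    (comm₁ qb x0 x1 x2 x3 y0 y1 y2 y3)
    (comm₁ qa x0 x2 x1 x3 y0 y2 y1 y3)
    (comm₃ x0 x1 x2 x3 y0 y1 y2 y3)

  *K-distribˡ-+K : ∀ x y z → x *K (y +K z) ≡ x *K y +K x *K z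
  *K-distribˡ-+K ⟨ x0 , x1 , x2 , x3 ⟩ ⟨ y0 , y1 , y2 , y3 ⟩ ⟨ z0 , z1 , z2 , z3 ⟩ = K-≡
    (distrib₀ qa qb x0 x1 x2 x3 y0 y1 y2 y3 z0 z1 z2 z3)
    (distrib₁ qb x0 x1 x2 x3 y0 y1 y2 y3 z0 z1 z2 z3)
    (distrib₁ qa x0 x2 x1 x3 y0 y2 y1 y3 z0 z2 z1 z3)
    (distrib₃ x0 x1 x2 x3 y0 y1 y2 y3 z0 z1 z2 z3)

  embℤ-*K : ∀ k x0 x1 x2 x3 → let q = k ℚ./ 1 in
    embℤ k *K ⟨ x0 , x1 , x2 , x3 ⟩ ≡ ⟨ q ℚ.* x0 , q ℚ.* x1 , q ℚ.* x2 , q ℚ.* x3 ⟩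
  embℤ-*K k x0 x1 x2 x3 = K-≡
    (scalar₀ qa qb (k ℚ./ 1) x0 x1 x2 x3)
    (scalar₁ qb (k ℚ./ 1) x0 x1 x2 x3)
    (scalar₁ qa (k ℚ./ 1) x0 x2 x1 x3)
    (scalar₃ (k ℚ./ 1) x0 x1 x2 x3)

  *K-identityˡ : ∀ x → oneK *K x ≡ x
  *K-identityˡ ⟨ x0 , x1 , x2 , x3 ⟩ = trans (embℤ-*K ℤ.1ℤ x0 x1 x2 x3)
    (K-≡ (ℚ.*-identityˡ x0) (ℚ.*-identityˡ x1) (ℚ.*-identityˡ x2) (ℚ.*-identityˡ x3))

  +K-*K-isCommutativeRing : IsCommutativeRing _≡_ _+K_ _*K_ -K_ zeroK oneK
  +K-*K-isCommutativeRing = record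
    { isRing = record
      { +-isAbelianGroup = record
        { isGroup = record
          { isMonoid = record
            { isSemigroup = record
              { isMagma = record { isEquivalence = isEquivalence ; ∙-cong = cong₂ _+K_ }
              ; assoc = +K-assoc
              }
            ; identity = comm∧idˡ⇒id +K-comm
                (λ x → K-≡ (ℚ.+-identityˡ _) (ℚ.+-identityˡ _) (ℚ.+-identityˡ _) (ℚ.+-identityˡ _))
            }
          ; inverse = comm∧invˡ⇒inv +K-comm
              (λ x → K-≡ (ℚ.+-inverseˡ (K.c0 x)) (ℚ.+-inverseˡ (K.c1 x)) (ℚ.+-inverseˡ (K.c2 x)) (ℚ.+-inverseˡ (K.c3 x)))
          ; ⁻¹-cong = cong -K_
          }
        ; comm = +K-comm
        }
      ; *-cong = cong₂ _*K_
      ; *-assoc = *K-assoc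
      ; *-identity = comm∧idˡ⇒id *K-comm *K-identityˡ
      ; distrib = comm∧distrˡ⇒distr (cong₂ _+K_) *K-comm *K-distribˡ-+K
      }
    ; *-comm = *K-comm
    }
    where
    open import Algebra.Consequences.Setoid (setoid K)
    +K-comm : ∀ x y → x +K y ≡ y +K x
    +K-comm ⟨ x0 , x1 , x2 , x3 ⟩ ⟨ y0 , y1 , y2 , y3 ⟩ =
      K-≡ (ℚ.+-comm x0 y0) (ℚ.+-comm x1 y1) (ℚ.+-comm x2 y2) (ℚ.+-comm x3 y3)

    +K-assoc : ∀ x y z → (x +K y) +K z ≡ x +K (y +K z)
    +K-assoc ⟨ x0 , x1 , x2 , x3 ⟩ ⟨ y0 , y1 , y2 , y3 ⟩ ⟨ z0 , z1 , z2 , z3 ⟩ =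
      K-≡ (ℚ.+-assoc x0 y0 z0) (ℚ.+-assoc x1 y1 z1) (ℚ.+-assoc x2 y2 z2) (ℚ.+-assoc x3 y3 z3)

  +K-*K-commutativeRing : CommutativeRing 0ℓ 0ℓ
  +K-*K-commutativeRing = record { isCommutativeRing = +K-*K-isCommutativeRing }

  embℤ-isRingHomomorphism : IsRingHomomorphism ℤ.+-*-rawRing (CommutativeRing.rawRing +K-*K-commutativeRing) embℤ
  embℤ-isRingHomomorphism = record
    { isSemiringHomomorphism = record
      { isNearSemiringHomomorphism = record
        { +-isMonoidHomomorphism = record
          { isMagmaHomomorphism = record
            { isRelHomomorphism = record { cong = cong embℤ }
            ; homo = λ i j → K-≡ (/1-homo-+ i j) refl refl refl
            }
          ; ε-homo = refl
          }
        ; *-homo = λ i j → sym (trans (embℤ-*K i (j ℚ./ 1) 0ℚ 0ℚ 0ℚ)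
            (K-≡ (sym (/1-homo-* i j)) (ℚ.*-zeroʳ (i ℚ./ 1)) (ℚ.*-zeroʳ (i ℚ./ 1)) (ℚ.*-zeroʳ (i ℚ./ 1))))
        }
      ; 1#-homo = refl
      }
    ; -‿homo = λ i → K-≡ (/1-homo-neg i) refl refl refl
    }

  √a √b : K
  √a = ⟨ 0ℚ , 1ℚ , 0ℚ , 0ℚ ⟩
  √b = ⟨ 0ℚ , 0ℚ , 1ℚ , 0ℚ ⟩

  √a*√a≡a : √a *K √a ≡ embℤ a
  √a*√a≡a = K-≡ (√a-square₀ qa qb) (√a-square₁ qb) (√a-square₂ qa) refl

  √b*√b≡b : √b *K √b ≡ embℤ b
  √b*√b≡b = K-≡ (√b-square₀ qa qb) (√a-square₂ qb) (√a-square₁ qa) refl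

  open Integrality +K-*K-commutativeRing embℤ embℤ-isRingHomomorphism

  -- Both notions are Horner recursions, so list entries and constructors correspond one to one, and
  -- the final `oneK` is the leading coefficient 1.
  evalMonic⇒Value : ∀ cs {x v} → evalMonic cs x ≡ v → Value x 1ℤ (length cs) v
  evalMonic⇒Value [] eq = const (sym eq)
  evalMonic⇒Value (c ∷ cs) eq = c +x* evalMonic⇒Value cs refl by sym eq

  Value⇒evalMonic : ∀ {x n v} → Value x 1ℤ n v → ∃ λ cs → evalMonic cs x ≡ v
  Value⇒evalMonic (const eq) = [] , sym eq
  Value⇒evalMonic {x} (c +x* p by eq) with Value⇒evalMonic p
  ... | cs , refl = c ∷ cs , sym eq

  IsAlgInt⇒Integral : ∀ {x} → IsAlgInt x → Integral x
  IsAlgInt⇒Integral (cs , eq) = length cs , evalMonic⇒Value cs eq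

  Integral⇒IsAlgInt : ∀ {x} → Integral x → IsAlgInt x
  Integral⇒IsAlgInt (n , p) = Value⇒evalMonic p

  imaginary⇒SumOfFiveIntSquares : ∀ s {d} → d ℤ.< 0ℤ → SquareFree d → s *K s ≡ embℤ d →
    ∀ β → IsAlgInt β → SumOfFiveIntSquares (embℤ (+ 4) *K β)
  imaginary⇒SumOfFiveIntSquares s {+ _} (+<+ ())
  imaginary⇒SumOfFiveIntSquares s { -[1+ n ]} _ d-sqfree s²≡d β β-int =
    let p₁ , p₂ , p₃ , p₄ , ∣p∣²≡-d = lagrange (suc n)
        w₁ , w₂ , w₃ , w₄ , w·p≡1 = unimodular { -[1+ n ]} p₁ p₂ p₃ p₄ d-sqfree ∣p∣²≡-d
        x₁ , x₂ , x₃ , x₄ , x₅ , i₁ , i₂ , i₃ , i₄ , i₅ , eq =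
          4β-sum-of-five-squares {s} {β} { -[1+ n ]} p₁ p₂ p₃ p₄ w₁ w₂ w₃ w₄ s²≡d ∣p∣²≡-d w·p≡1 (IsAlgInt⇒Integral β-int)
    in x₁ , x₂ , x₃ , x₄ , x₅ , Integral⇒IsAlgInt i₁ , Integral⇒IsAlgInt i₂ , Integral⇒IsAlgInt i₃ ,
       Integral⇒IsAlgInt i₄ , Integral⇒IsAlgInt i₅ , eq

-- The product ab may fail to be square-free, so √a√b is not a suitable s. When ab is negative, so
-- is a or b, and the root of that square-free factor takes its place.
i*j<0⇒i<0⊎j<0 : ∀ i j → i ℤ.* j ℤ.< 0ℤ → i ℤ.< 0ℤ ⊎ j ℤ.< 0ℤ
i*j<0⇒i<0⊎j<0 -[1+ _ ] j _ = inj₁ ℤ.-<+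
i*j<0⇒i<0⊎j<0 (+ _) -[1+ _ ] _ = inj₂ ℤ.-<+
i*j<0⇒i<0⊎j<0 (+ m) (+ n) mn<0 = contradiction (subst (ℤ._< 0ℤ) (sym (ℤ.pos-* m n)) mn<0) (λ { (+<+ ()) })

theorem3 : (a b : ℤ) → BiquadParams a b →
    (β : K) → Arith.IsAlgInt a b β →
    Arith.SumOfFiveIntSquares a b (Arith._*K_ a b (Arith.embℤ a b (+ 4)) β)
theorem3 a b params = [ via-√a , [ via-√b , [ via-√a , via-√b ]′ ∘ i*j<0⇒i<0⊎j<0 a b ]′ ]′ complex
  where
  open BiquadParams params
  open Field a b
  via-√a = λ a<0 → imaginary⇒SumOfFiveIntSquares √a a<0 sqfree-a √a*√a≡a
  via-√b = λ b<0 → imaginary⇒SumOfFiveIntSquares √b b<0 sqfree-b √b*√b≡b
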